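{- Let $A_n = A_n(h,T)$ be an apex tree with $n \ge 3$. Then the all-negative signature does not maximise the frustration index of $A_n$ uniquely; that is, it is not the case that both $l(-A_n) = l_{\max}(A_n)$ and every signature $\sigma$ of $A_n$ with $l(A_n,\sigma) = l_{\max}(A_n)$ is switching equivalent to the all-negative signature.
   Context: All graphs are finite, simple and undirected. A signed graph $\Sigma=(G,\sigma)$ is a graph $G$ with a signature $\sigma:E(G)\to\{+1,-1\}$. The sign of a cycle is the product of the signs of its edges; $\Sigma$ is balanced if all its cycles are positive. The frustration index $l(\Sigma)$ is the minimum number of edges whose deletion makes $\Sigma$ balanced. $-G$ is $G$ with all edges signed $-1$. $l_{\max}(G)=\max_\sigma l(G,\sigma)$ over all signatures of $G$. Switching $\Sigma$ at a vertex subset $X$ negates the signs of all edges with exactly one endpoint in $X$; two signatures of $G$ are switching equivalent if one is obtained from the other by switching. Apex tree: $A_n(h,T)$ denotes a graph with a vertex $h$ of degree $n$ such that deleting $h$ leaves the tree $T$. Standing assumptions: all leaves of $T$ are neighbours of $h$; the graph is $2$-connected; and every vertex of degree $2$ in the graph is contained in a triangle. -}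

module Defs where

open import Data.Bool using (Bool; true; false; T; not; _∧_; _xor_; if_then_else_)
open import Data.Bool.Properties using (T?; T-irrelevant; T-∧; ∧-comm; xor-comm)
open import Data.Empty using (⊥-elim)
open import Data.Fin as Fin using (Fin; zero; suc; toℕ; fromℕ<; punchIn; combine; remQuot)
import Data.Fin.Properties as Fin
open import Data.Fin.Subset using (Subset; ∣_∣)
open import Data.Fin.Subset.Properties using (anySubset?)
open import Data.List as List using (List; []; _∷_; length; filter; cartesianProduct; allFin)
open import Data.List.Membership.Propositional.Properties using (∈-lookup)
open import Data.List.Properties using (filter-≐)
import Data.List.Relation.Unary.All as All
open import Data.List.Relation.Unary.AllPairs using ([]; _∷_)
open import Data.List.Relation.Unary.Unique.Propositional using (Unique)
import Data.List.Relation.Unary.Unique.DecPropositional as DecUnique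
open import Data.Nat as ℕ using (ℕ; zero; suc; _≤_; z≤n; s≤s)
import Data.Nat.Properties as ℕ
open import Data.Product using (Σ; ∃; ∃₂; _×_; _,_; proj₁; proj₂)
open import Data.Sign as Sign using (Sign)
import Data.Sign.Properties as Sign
open import Data.Unit using (tt)
open import Data.Vec using (lookup; tabulate)
open import Data.Vec.Properties using (lookup∘tabulate)
open import Function using (_∘_; Equivalence)
open import Relation.Binary.PropositionalEquality
open import Relation.Nullary using (¬_; Dec; yes; no)
open import Relation.Nullary.Decidable using (_×-dec_; _→-dec_; map′)

------------------------------------------------------------------------
-- Graphs

record Graph (m : ℕ) : Set where
  field
    adj        : Fin m → Fin m → Bool
    adj-sym    : ∀ u v → adj u v ≡ adj v u
    adj-irrefl : ∀ v → adj v v ≡ false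

open Graph public

Adj : ∀ {m} → Graph m → Fin m → Fin m → Set
Adj G u v = T (adj G u v)

neighbours : ∀ {m} → Graph m → Fin m → Subset m
neighbours G v = tabulate (adj G v)

degree : ∀ {m} → Graph m → Fin m → ℕ
degree G v = ∣ neighbours G v ∣

-- Each edge is listed once, with its smaller endpoint first.
edges : ∀ {m} → Graph m → List (Fin m × Fin m)
edges {m} G =
  filter (λ (u , v) → (u Fin.<? v) ×-dec T? (adj G u v))
         (cartesianProduct (allFin m) (allFin m))

size : ∀ {m} → Graph m → ℕ
size G = length (edges G)

-- A set of edges of G is represented by a spanning subgraph F ⊑ G.
_⊑_ : ∀ {m} → Graph m → Graph m → Set
F ⊑ G = ∀ u v → Adj F u v → Adj G u v

infixl 6 _∖_ _-_

_∖_ : ∀ {m} → Graph m → Graph m → Graph m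
(G ∖ F) .adj u v = adj G u v ∧ not (adj F u v)
(G ∖ F) .adj-sym u v = cong₂ (λ a b → a ∧ not b) (adj-sym G u v) (adj-sym F u v)
(G ∖ F) .adj-irrefl v = cong (_∧ not (adj F v v)) (adj-irrefl G v)

∖-⊑ : ∀ {m} (G F : Graph m) → (G ∖ F) ⊑ G
∖-⊑ G F u v e = proj₁ (Equivalence.to T-∧ e)

-- Deletion of a vertex; punchIn h enumerates the vertices other than h.
_-_ : ∀ {m} → Graph (suc m) → Fin (suc m) → Graph m
(G - h) .adj u v = adj G (punchIn h u) (punchIn h v)
(G - h) .adj-sym u v = adj-sym G (punchIn h u) (punchIn h v)
(G - h) .adj-irrefl v = adj-irrefl G (punchIn h v)

infixr 5 _◅_

-- A copy of Star (Adj G) from which G can be inferred.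
data Walk {m} (G : Graph m) : Fin m → Fin m → Set where
  ε   : ∀ {u} → Walk G u u
  _◅_ : ∀ {u v w} → Adj G u v → Walk G v w → Walk G u w

-- The vertices of a walk in order, except the last one.
sources : ∀ {m} {G : Graph m} {u v} → Walk G u v → List (Fin m)
sources ε = []
sources (_◅_ {u} e p) = u ∷ sources p

IsCycle : ∀ {m} {G : Graph m} {u} → Walk G u u → Set
IsCycle p = 3 ≤ length (sources p) × Unique (sources p)

record Connected {m} (G : Graph m) : Set where
  field
    nonempty : 1 ≤ m
    walk     : ∀ u v → Walk G u v

record IsTree {m} (G : Graph m) : Set where
  field
    connected : Connected G
    acyclic   : ∀ {u} (p : Walk G u u) → ¬ IsCycle p

record TwoConnected {m} (G : Graph (suc m)) : Set where
  field
    order       : 3 ≤ suc m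
    connected   : Connected G
    noCutVertex : ∀ v → Connected (G - v)

InTriangle : ∀ {m} → Graph m → Fin m → Set
InTriangle G v = ∃₂ λ a b → Adj G v a × Adj G a b × Adj G b v

-- G is an apex tree Aₙ(h , T) with T = G - h.
record IsApexTree {m} (n : ℕ) (G : Graph (suc m)) (h : Fin (suc m)) : Set where
  field
    apexDegree   : degree G h ≡ n
    tree         : IsTree (G - h)
    leaves       : ∀ v → degree (G - h) v ≡ 1 → Adj G h (punchIn h v)
    twoConnected : TwoConnected G
    triangles    : ∀ v → degree G v ≡ 2 → InTriangle G v

------------------------------------------------------------------------
-- Signed graphs

-- A sign for each edge; as Adj is proof-irrelevant, sign-sym says that the
-- sign does not depend on the orientation.
record Signature {m} (G : Graph m) : Set where
  field
    sign     : ∀ u v → Adj G u v → Sign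
    sign-sym : ∀ u v (e : Adj G u v) (e′ : Adj G v u) → sign u v e ≡ sign v u e′

open Signature public

_≗ₛ_ : ∀ {m} {G : Graph m} → Signature G → Signature G → Set
_≗ₛ_ {G = G} σ τ = ∀ u v (e : Adj G u v) → sign σ u v e ≡ sign τ u v e

allNegative : ∀ {m} (G : Graph m) → Signature G
allNegative G .sign u v e = Sign.-
allNegative G .sign-sym u v e e′ = refl

restrict : ∀ {m} {F G : Graph m} → F ⊑ G → Signature G → Signature F
restrict F⊑G σ .sign u v e = sign σ u v (F⊑G u v e)
restrict F⊑G σ .sign-sym u v e e′ = sign-sym σ u v (F⊑G u v e) (F⊑G v u e′)

switch : ∀ {m} {G : Graph m} → Subset m → Signature G → Signature G
switch X σ .sign u v e =
  if lookup X u xor lookup X v then Sign.opposite (sign σ u v e) else sign σ u v e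
switch X σ .sign-sym u v e e′ =
  cong₂ (λ b s → if b then Sign.opposite s else s)
        (xor-comm (lookup X u) (lookup X v)) (sign-sym σ u v e e′)

SwitchingEquivalent : ∀ {m} {G : Graph m} → Signature G → Signature G → Set
SwitchingEquivalent {m} σ τ = Σ (Subset m) λ X → switch X σ ≗ₛ τ

walkSign : ∀ {m} {G : Graph m} → Signature G → ∀ {u v} → Walk G u v → Sign
walkSign σ ε = Sign.+
walkSign σ (e ◅ p) = sign σ _ _ e Sign.* walkSign σ p

Balanced : ∀ {m} {G : Graph m} → Signature G → Set
Balanced {G = G} σ = ∀ {u} (p : Walk G u u) → IsCycle p → walkSign σ p ≡ Sign.+

BalancedAfterDeleting : ∀ {m} {G : Graph m} → Signature G → Graph m → Set
BalancedAfterDeleting {G = G} σ F = Balanced {G = G ∖ F} (restrict (∖-⊑ G F) σ)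

-- σ can be made balanced by deleting exactly k edges.
BalancedByDeleting : ∀ {m} {G : Graph m} → Signature G → ℕ → Set
BalancedByDeleting {m} {G} σ k =
  Σ (Graph m) λ F → F ⊑ G × size F ≡ k × BalancedAfterDeleting σ F

IsMinimum IsMaximum : (ℕ → Set) → ℕ → Set
IsMinimum P k = P k × (∀ j → P j → k ≤ j)
IsMaximum P k = P k × (∀ j → P j → j ≤ k)

------------------------------------------------------------------------
-- Extrema of decidable predicates

minimum : (P : ℕ → Set) → (∀ j → Dec (P j)) → ∀ k → P k → ∃ (IsMinimum P)
minimum P P? zero p = 0 , p , λ _ _ → z≤n
minimum P P? (suc k) p with P? 0
... | yes p₀ = 0 , p₀ , λ _ _ → z≤n
... | no ¬p₀ with minimum (P ∘ suc) (P? ∘ suc) k p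
...   | j , q , least = suc j , q , λ where
        zero    p₀ → ⊥-elim (¬p₀ p₀)
        (suc i) r  → s≤s (least i r)

maximum : (P : ℕ → Set) → (∀ j → Dec (P j)) → ∃ P →
          ∀ b → (∀ j → P j → j ≤ b) → ∃ (IsMaximum P)
maximum P P? (k , p) zero bound = 0 , subst P (ℕ.n≤0⇒n≡0 (bound k p)) p , bound
maximum P P? w (suc b) bound with P? (suc b)
... | yes q = suc b , q , bound
... | no ¬q = maximum P P? w b λ j p →
      ℕ.≤-pred (ℕ.≤∧≢⇒< (bound j p) λ where refl → ¬q p)

------------------------------------------------------------------------
-- Balance is decidable

lookup-≢ : ∀ {A : Set} {xs : List A} → Unique xs →
           ∀ i j → i Fin.< j → List.lookup xs i ≢ List.lookup xs j
lookup-≢ (x∉ ∷ _) zero (suc j) _ = All.lookup x∉ (∈-lookup j)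
lookup-≢ (_ ∷ u) (suc i) (suc j) (s≤s i<j) = lookup-≢ u i j i<j

unique⇒length≤ : ∀ {m} {xs : List (Fin m)} → Unique xs → length xs ≤ m
unique⇒length≤ {m} {xs} u = ℕ.≮⇒≥ λ m<l →
  let i , j , i<j , eq = Fin.pigeonhole m<l (List.lookup xs)
  in lookup-≢ u i j i<j eq

allT? : ∀ b (Q : T b → Set) → (∀ e → Dec (Q e)) → Dec (∀ e → Q e)
allT? true  Q Q? = map′ (λ q _ → q) (λ q → q tt) (Q? tt)
allT? false Q Q? = yes λ ()

allWalks? : ∀ {m} {G : Graph m} k u v (Q : Walk G u v → Set) → (∀ p → Dec (Q p)) →
            Dec (∀ p → length (sources p) ≡ k → Q p)
allWalks? zero u v Q Q? with u Fin.≟ v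
... | no u≢v = no-walk
  where
  no-walk : Dec (∀ p → length (sources p) ≡ 0 → Q p)
  no-walk = yes λ where ε _ → ⊥-elim (u≢v refl)
... | yes refl = map′ (λ q → λ where ε _ → q) (λ q → q ε refl) (Q? ε)
allWalks? {G = G} (suc k) u v Q Q? =
  map′ (λ f → λ where (e ◅ p) eq → f _ e p (ℕ.suc-injective eq))
       (λ f w e p eq → f (e ◅ p) (cong suc eq))
       (Fin.all? λ w → allT? (adj G u w) _ λ e →
         allWalks? k w v (λ p → Q (e ◅ p)) (λ p → Q? (e ◅ p)))

isCycle? : ∀ {m} {G : Graph m} {u} (p : Walk G u u) → Dec (IsCycle p)
isCycle? p = (3 ℕ.≤? length (sources p)) ×-dec DecUnique.unique? Fin._≟_ (sources p)

balanced? : ∀ {m} {G : Graph m} (σ : Signature G) → Dec (Balanced σ)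
balanced? {m} {G} σ =
  map′ (λ f {u} p c →
          f u (fromℕ< (s≤s (unique⇒length≤ (proj₂ c)))) p (sym (Fin.toℕ-fromℕ< _)) c)
       (λ f u k p _ → f p)
       (Fin.all? λ u → Fin.all? {n = suc m} λ k →
         allWalks? (toℕ k) u u (λ p → IsCycle p → walkSign σ p ≡ Sign.+)
           λ p → isCycle? p →-dec (walkSign σ p Sign.≟ Sign.+))

------------------------------------------------------------------------
-- Graphs and signatures up to pointwise equality can be searched exhaustively

_≗ᵍ_ : ∀ {m} → Graph m → Graph m → Set
F ≗ᵍ H = ∀ u v → adj F u v ≡ adj H u v

size-cong : ∀ {m} {F H : Graph m} → F ≗ᵍ H → size F ≡ size H
size-cong {m} {F} {H} eq = cong length
  (filter-≐ (λ (u , v) → (u Fin.<? v) ×-dec T? (adj F u v))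
            (λ (u , v) → (u Fin.<? v) ×-dec T? (adj H u v))
            ( (λ {(u , v)} (lt , e) → lt , subst T (eq u v) e)
            , (λ {(u , v)} (lt , e) → lt , subst T (sym (eq u v)) e))
            (cartesianProduct (allFin m) (allFin m)))

module _ {m} {F H : Graph m} (σ : Signature F) (τ : Signature H) (F⊑H : F ⊑ H)
         (agree : ∀ u v e → sign σ u v e ≡ sign τ u v (F⊑H u v e)) where

  embed : ∀ {u v} → Walk F u v → Walk H u v
  embed ε = ε
  embed (e ◅ p) = F⊑H _ _ e ◅ embed p

  sources-embed : ∀ {u v} (p : Walk F u v) → sources (embed p) ≡ sources p
  sources-embed ε = refl
  sources-embed (e ◅ p) = cong (_ ∷_) (sources-embed p)

  walkSign-embed : ∀ {u v} (p : Walk F u v) → walkSign σ p ≡ walkSign τ (embed p)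
  walkSign-embed ε = refl
  walkSign-embed (e ◅ p) = cong₂ Sign._*_ (agree _ _ e) (walkSign-embed p)

  balanced-⊑ : Balanced τ → Balanced σ
  balanced-⊑ b p c = trans (walkSign-embed p)
    (b (embed p) (subst (λ xs → 3 ≤ length xs × Unique xs) (sym (sources-embed p)) c))

balancedAfterDeleting-cong :
  ∀ {m} {G : Graph m} {σ τ : Signature G} {F H : Graph m} → σ ≗ₛ τ → F ≗ᵍ H →
  BalancedAfterDeleting τ H → BalancedAfterDeleting σ F
balancedAfterDeleting-cong {G = G} {σ} {τ} {F} {H} σ≗τ F≗H =
  balanced-⊑ (restrict (∖-⊑ G F) σ) (restrict (∖-⊑ G H) τ) inc
    λ u v e → trans (σ≗τ u v _) (cong (sign τ u v) (T-irrelevant _ _))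
  where
  inc : (G ∖ F) ⊑ (G ∖ H)
  inc u v = subst (λ b → T (adj G u v ∧ not b)) (F≗H u v)

Table : ℕ → Set
Table m = Subset (m ℕ.* m)

entry : ∀ {m} → Table m → Fin m → Fin m → Bool
entry t u v = lookup t (combine u v)

table : ∀ {m} → (Fin m → Fin m → Bool) → Table m
table {m} f = tabulate λ i → f (proj₁ (remQuot {m} m i)) (proj₂ (remQuot {m} m i))

entry-table : ∀ {m} (f : Fin m → Fin m → Bool) u v → entry (table f) u v ≡ f u v
entry-table {m} f u v = trans (lookup∘tabulate _ (combine u v))
  (cong (λ (a , b) → f a b) (Fin.remQuot-combine {m} u v))

∧-idem-sym : ∀ {a b} → a ≡ b → a ∧ b ≡ a
∧-idem-sym {false} refl = refl
∧-idem-sym {true}  refl = refl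

isDistinct : ∀ {m} → Fin m → Fin m → Bool
isDistinct u v with u Fin.≟ v
... | yes _ = false
... | no  _ = true

isDistinct-sym : ∀ {m} (u v : Fin m) → isDistinct u v ≡ isDistinct v u
isDistinct-sym u v with u Fin.≟ v | v Fin.≟ u
... | yes _    | yes _    = refl
... | no _     | no _     = refl
... | yes refl | no v≢v   = ⊥-elim (v≢v refl)
... | no u≢u   | yes refl = ⊥-elim (u≢u refl)

isDistinct-irrefl : ∀ {m} (v : Fin m) → isDistinct v v ≡ false
isDistinct-irrefl v with v Fin.≟ v
... | yes _  = refl
... | no v≢v = ⊥-elim (v≢v refl)

fromTable : ∀ {m} → Table m → Graph m
fromTable t .adj u v = isDistinct u v ∧ (entry t u v ∧ entry t v u)
fromTable t .adj-sym u v =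
  cong₂ _∧_ (isDistinct-sym u v) (∧-comm (entry t u v) (entry t v u))
fromTable t .adj-irrefl v =
  cong (_∧ (entry t v v ∧ entry t v v)) (isDistinct-irrefl v)

fromTable-table : ∀ {m} (F : Graph m) → fromTable (table (adj F)) ≗ᵍ F
fromTable-table F u v = trans
  (cong (isDistinct u v ∧_)
    (trans (cong₂ _∧_ (entry-table (adj F) u v) (entry-table (adj F) v u))
           (∧-idem-sym (adj-sym F u v))))
  drop
  where
  drop : isDistinct u v ∧ adj F u v ≡ adj F u v
  drop with u Fin.≟ v
  ... | yes refl = sym (adj-irrefl F u)
  ... | no _     = refl

anyGraph? : ∀ {m} (Q : Graph m → Set) → (∀ F → Dec (Q F)) →
            (∀ {F H} → F ≗ᵍ H → Q H → Q F) → Dec (∃ Q)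
anyGraph? Q Q? resp =
  map′ (λ (t , q) → fromTable t , q)
       (λ (F , q) → table (adj F) , resp (fromTable-table F) q)
       (anySubset? (Q? ∘ fromTable))

toSign : Bool → Sign
toSign true  = Sign.-
toSign false = Sign.+

isNegative : Sign → Bool
isNegative Sign.- = true
isNegative Sign.+ = false

toSign-isNegative : ∀ s → toSign (isNegative s) ≡ s
toSign-isNegative Sign.- = refl
toSign-isNegative Sign.+ = refl

signatureFromTable : ∀ {m} (G : Graph m) → Table m → Signature G
signatureFromTable G t .sign u v e = toSign (entry t u v ∧ entry t v u)
signatureFromTable G t .sign-sym u v e e′ =
  cong toSign (∧-comm (entry t u v) (entry t v u))

negative : ∀ {m} {G : Graph m} → Signature G → Fin m → Fin m → Bool
negative {G = G} σ u v with T? (adj G u v)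
... | yes e = isNegative (sign σ u v e)
... | no _  = false

negative-edge : ∀ {m} {G : Graph m} (σ : Signature G) u v (e : Adj G u v) →
                negative σ u v ≡ isNegative (sign σ u v e)
negative-edge {G = G} σ u v e with T? (adj G u v)
... | yes e′ = cong (isNegative ∘ sign σ u v) (T-irrelevant e′ e)
... | no ¬e  = ⊥-elim (¬e e)

signatureFromTable-table : ∀ {m} {G : Graph m} (σ : Signature G) →
                           signatureFromTable G (table (negative σ)) ≗ₛ σ
signatureFromTable-table {G = G} σ u v e = trans
  (cong toSign
    (trans (cong₂ _∧_ (entry-table (negative σ) u v) (entry-table (negative σ) v u))
      (trans (∧-idem-sym negative-sym) (negative-edge σ u v e))))
  (toSign-isNegative (sign σ u v e))
  where
  e′ : Adj G v u
  e′ = subst T (adj-sym G u v) e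

  negative-sym : negative σ u v ≡ negative σ v u
  negative-sym = trans (negative-edge σ u v e)
    (trans (cong isNegative (sign-sym σ u v e e′)) (sym (negative-edge σ v u e′)))

anySignature? : ∀ {m} {G : Graph m} (Q : Signature G → Set) → (∀ σ → Dec (Q σ)) →
                (∀ {σ τ} → σ ≗ₛ τ → Q τ → Q σ) → Dec (∃ Q)
anySignature? {G = G} Q Q? resp =
  map′ (λ (t , q) → signatureFromTable G t , q)
       (λ (σ , q) → table (negative σ) , resp (signatureFromTable-table σ) q)
       (anySubset? (Q? ∘ signatureFromTable G))

------------------------------------------------------------------------
-- The frustration index and its maximum over all signatures

balancedByDeleting-cong : ∀ {m} {G : Graph m} {σ τ : Signature G} → σ ≗ₛ τ →
                          ∀ k → BalancedByDeleting τ k → BalancedByDeleting σ k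
balancedByDeleting-cong {σ = σ} {τ} eq k (F , F⊑G , size≡ , b) =
  F , F⊑G , size≡ ,
  balancedAfterDeleting-cong {σ = σ} {τ} {F} {F} eq (λ _ _ → refl) b

balancedByDeleting? : ∀ {m} {G : Graph m} (σ : Signature G) k →
                      Dec (BalancedByDeleting σ k)
balancedByDeleting? {G = G} σ k = anyGraph? _
  (λ F → (Fin.all? λ u → Fin.all? λ v → T? (adj F u v) →-dec T? (adj G u v))
         ×-dec (size F ℕ.≟ k) ×-dec balanced? (restrict (∖-⊑ G F) σ))
  λ {F} {H} eq (H⊑G , size≡ , b) →
    (λ u v e → H⊑G u v (subst T (eq u v) e)) ,
    trans (size-cong {F = F} {H} eq) size≡ ,
    balancedAfterDeleting-cong {σ = σ} {σ} {F} {H} (λ _ _ _ → refl) eq b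

delete-all : ∀ {m} {G : Graph m} (σ : Signature G) → BalancedByDeleting σ (size G)
delete-all {G = G} σ = G , (λ _ _ e → e) , refl , balanced
  where
  ¬T-∧-not : ∀ b → ¬ T (b ∧ not b)
  ¬T-∧-not false ()
  ¬T-∧-not true  ()

  balanced : BalancedAfterDeleting σ G
  balanced ε _ = refl
  balanced (_◅_ {u} {v} e p) _ = ⊥-elim (¬T-∧-not (adj G u v) e)

abstract
  frustrationIndex-exists : ∀ {m} {G : Graph m} (σ : Signature G) →
                            ∃ (IsMinimum (BalancedByDeleting σ))
  frustrationIndex-exists {G = G} σ =
    minimum _ (balancedByDeleting? σ) (size G) (delete-all σ)

frustrationIndex : ∀ {m} {G : Graph m} → Signature G → ℕ
frustrationIndex σ = proj₁ (frustrationIndex-exists σ)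

frustrationIndex-isMinimum : ∀ {m} {G : Graph m} (σ : Signature G) →
  IsMinimum (BalancedByDeleting σ) (frustrationIndex σ)
frustrationIndex-isMinimum σ = proj₂ (frustrationIndex-exists σ)

frustrationIndex-cong : ∀ {m} {G : Graph m} {σ τ : Signature G} → σ ≗ₛ τ →
                        frustrationIndex σ ≡ frustrationIndex τ
frustrationIndex-cong {σ = σ} {τ} eq = ℕ.≤-antisym
  (proj₂ (frustrationIndex-isMinimum σ) _
    (balancedByDeleting-cong {σ = σ} {τ} eq _ (proj₁ (frustrationIndex-isMinimum τ))))
  (proj₂ (frustrationIndex-isMinimum τ) _
    (balancedByDeleting-cong {σ = τ} {σ} (λ u v e → sym (eq u v e)) _
      (proj₁ (frustrationIndex-isMinimum σ))))

IsFrustrationIndexOf : ∀ {m} → Graph m → ℕ → Set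
IsFrustrationIndexOf G k = Σ (Signature G) λ σ → frustrationIndex σ ≡ k

abstract
  maxFrustrationIndex-exists : ∀ {m} (G : Graph m) →
                               ∃ (IsMaximum (IsFrustrationIndexOf G))
  maxFrustrationIndex-exists G = maximum _
    (λ k → anySignature? _ (λ σ → frustrationIndex σ ℕ.≟ k)
             λ {σ} {τ} eq → trans (frustrationIndex-cong {σ = σ} {τ} eq))
    (_ , allNegative G , refl)
    (size G)
    λ where _ (σ , refl) → proj₂ (frustrationIndex-isMinimum σ) _ (delete-all σ)

maxFrustrationIndex : ∀ {m} → Graph m → ℕ
maxFrustrationIndex G = proj₁ (maxFrustrationIndex-exists G)

maxFrustrationIndex-isMaximum : ∀ {m} (G : Graph m) →
  IsMaximum (IsFrustrationIndexOf G) (maxFrustrationIndex G)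
maxFrustrationIndex-isMaximum G = proj₂ (maxFrustrationIndex-exists G)

{-# OPTIONS --safe #-}
module Submission where

open import Defs
open import Data.Bool using (Bool; true; false; T; not; _∧_; _∨_; _xor_; if_then_else_)
open import Data.Bool.Properties using (T?; T-irrelevant; T-∧; T-∨; T-≡; ∧-comm; ∨-comm; xor-same)
open import Data.Empty using (⊥-elim)
open import Data.Fin as Fin using (Fin; zero; suc; punchIn; punchOut)
import Data.Fin.Properties as Fin
open import Data.Fin.Subset using (Subset; inside; outside; ∣_∣; _∈_; _⊆_; _∪_; ⁅_⁆)
open import Data.Fin.Subset.Properties
  using (p⊆q⇒∣p∣≤∣q∣; ∣⁅x⁆∣≡1; x∈⁅x⁆; p⊆p∪q; q⊆p∪q; x∈p⇒∣p-x∣<∣p∣; x∈p∧x≢y⇒x∈p-y)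
open import Data.List as List using (List; []; _∷_; _++_; length)
open import Data.List.Membership.Propositional using () renaming (_∈_ to _∈ₗ_)
open import Data.List.Membership.Propositional.Properties
  using (∈-lookup; ∈-allFin; ∈-cartesianProduct⁺; ∈-filter⁺; ∈-filter⁻)
open import Data.List.Properties using (length-++)
open import Data.List.Relation.Unary.All as All using (All; []; _∷_)
import Data.List.Relation.Unary.All.Properties as All
open import Data.List.Relation.Unary.AllPairs using ([]; _∷_)
open import Data.List.Relation.Unary.Any using (here; there; index; any?)
open import Data.List.Relation.Unary.Any.Properties using (lookup-index)
open import Data.List.Relation.Unary.Unique.Propositional using (Unique)
import Data.List.Relation.Unary.Unique.Propositional.Properties as Unique
open import Data.Nat as ℕ using (ℕ; zero; suc; _≤_; _<_; _≥_; _+_; z≤n; s≤s)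
import Data.Nat.Properties as ℕ
open import Data.Product using (Σ; ∃; ∃₂; _×_; _,_; proj₁; proj₂)
open import Data.Sign as Sign using (Sign; _*_)
import Data.Sign.Properties as Sign
open import Data.Sum using (_⊎_; inj₁; inj₂)
open import Data.Vec using ([]; _∷_; lookup; tabulate)
open import Data.Vec.Functional using (updateAt)
open import Data.Vec.Functional.Properties using (updateAt-updates; updateAt-minimal)
open import Data.Vec.Properties using (lookup∘tabulate; []=⇒lookup; lookup⇒[]=)
open import Function using (_∘_; id; const; Equivalence)
open import Relation.Binary.Definitions using (tri<; tri≈; tri>)
open import Relation.Binary.PropositionalEquality
open import Relation.Nullary using (¬_; yes; no; contradiction)
open import Relation.Nullary.Decidable using (_×-dec_; ¬?; ⌊_⌋; fromWitness)

-- A leaf b of the tree has degree 2 in G, so it lies in a triangle b h c with c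
-- its neighbour in the tree.  Reversing the signs of hb and hc keeps this
-- triangle negative, and it preserves the frustration index: a deletion set
-- that balances one signature contains an edge of the triangle, and exchanging
-- edges of the triangle makes it balance the other one.  To see the latter,
-- contract b onto a neighbour.  A set X switching the new signature to the
-- all-negative one would separate h from b but no two adjacent vertices of the
-- tree, and it would not separate h from its third neighbour: a contradiction.

-- Walks

infixr 5 _◅◅_

_◅◅_ : ∀ {m} {G : Graph m} {u v w} → Walk G u v → Walk G v w → Walk G u w
ε ◅◅ q = q
(e ◅ p) ◅◅ q = e ◅ (p ◅◅ q)

sources-◅◅ : ∀ {m} {G : Graph m} {u v w} (p : Walk G u v) (q : Walk G v w) →
             sources (p ◅◅ q) ≡ sources p ++ sources q
sources-◅◅ ε q = refl
sources-◅◅ (e ◅ p) q = cong (_ ∷_) (sources-◅◅ p q)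

walkSign-◅◅ : ∀ {m} {G : Graph m} (σ : Signature G) {u v w}
              (p : Walk G u v) (q : Walk G v w) →
              walkSign σ (p ◅◅ q) ≡ walkSign σ p * walkSign σ q
walkSign-◅◅ σ ε q = refl
walkSign-◅◅ σ (e ◅ p) q =
  trans (cong (sign σ _ _ e *_) (walkSign-◅◅ σ p q))
        (sym (Sign.*-assoc (sign σ _ _ e) (walkSign σ p) (walkSign σ q)))

walkLength : ∀ {m} {G : Graph m} {u v} → Walk G u v → ℕ
walkLength p = length (sources p)

walkLength-◅◅ : ∀ {m} {G : Graph m} {u v w} (p : Walk G u v) (q : Walk G v w) →
                walkLength (p ◅◅ q) ≡ walkLength p + walkLength q
walkLength-◅◅ p q = trans (cong length (sources-◅◅ p q)) (length-++ (sources p))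

splitAt : ∀ {m} {G : Graph m} {u w} (p : Walk G u w) {x} → x ∈ₗ sources p →
          ∃₂ λ (q : Walk G u x) y → Σ (Adj G x y) λ e → Σ (Walk G y w) λ r →
          p ≡ q ◅◅ e ◅ r
splitAt (e ◅ p) (here refl) = ε , _ , e , p , refl
splitAt (e ◅ p) (there x∈p) with splitAt p x∈p
... | q , y , f , r , refl = e ◅ q , y , f , r , refl

-- For closing up a path that meets its vertex `x` again: what precedes `x`, together with `x`,
-- supplies the distinct vertices of a cycle through `x`.
unique-rotate : ∀ {A : Set} (xs : List A) {x ys} → Unique (xs ++ x ∷ ys) → Unique (x ∷ xs)
unique-rotate [] _ = [] ∷ []
unique-rotate (y ∷ xs) (y∉ ∷ u) with unique-rotate xs u | All.++⁻ʳ xs y∉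
... | x∉ ∷ uxs | y≢x ∷ _ = (≢-sym y≢x ∷ x∉) ∷ All.++⁻ˡ xs y∉ ∷ uxs

-- The end of a walk is not among its `sources`, so a closed walk can be `simple`. In `detour` the
-- closed walk `e ◅ c` at a repeated source can be cut out; as it and `f ◅ q` are both non-empty,
-- this leaves two shorter walks.
data Simplicity {m} {G : Graph m} {u w} : Walk G u w → Set where
  simple : ∀ {p} → Unique (sources p) → Simplicity p
  detour : ∀ {x y z} (p : Walk G u x) (e : Adj G x y) (c : Walk G y x)
           (f : Adj G x z) (q : Walk G z w) → Simplicity (p ◅◅ (e ◅ c) ◅◅ (f ◅ q))

simplicity : ∀ {m} {G : Graph m} {u w} (p : Walk G u w) → Simplicity p
simplicity ε = simple []
simplicity (_◅_ {u} e p) with any? (u Fin.≟_) (sources p)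
... | yes u∈p with splitAt p u∈p
...   | c , _ , f , q , refl = detour ε e c f q
simplicity (_◅_ {u} e p) | no u∉p with simplicity p
... | simple uniq = simple (All.¬Any⇒All¬ _ u∉p ∷ uniq)
... | detour p₁ e₁ c f q = detour (e ◅ p₁) e₁ c f q

-- Balance and closed walks

-- A closed walk that is neither a cycle nor a backtracking edge splits into
-- two shorter closed walks at a repeated vertex.
closedWalk-positive : ∀ {m} {G : Graph m} {σ : Signature G} → Balanced σ →
                      ∀ {u} (p : Walk G u u) → walkSign σ p ≡ Sign.+
closedWalk-positive {G = G} {σ} bal p = bounded (suc (walkLength p)) p ℕ.≤-refl
  where
  open ℕ.≤-Reasoning

  bounded : ∀ k {u} (p : Walk G u u) → walkLength p < k → walkSign σ p ≡ Sign.+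
  bounded (suc k) p (s≤s p≤k) with simplicity p
  ... | simple uniq with p
  ...   | ε = refl
  ...   | e ◅ ε = ⊥-elim (subst T (adj-irrefl G _) e)
  -- An edge traversed to and fro contributes the square of its sign.
  ...   | _◅_ {u} e (_◅_ {v} f ε) =
          trans (cong (sign σ u v e *_)
                  (trans (Sign.*-identityʳ _) (sym (sign-sym σ u v e f))))
                (Sign.s*s≡+ (sign σ u v e))
  ...   | e ◅ f ◅ g ◅ q = bal (e ◅ f ◅ g ◅ q) (s≤s (s≤s (s≤s z≤n)) , uniq)
  bounded (suc k) _ (s≤s l≤k) | detour p e c f q =
    trans (walkSign-◅◅ σ p _)
      (trans (cong (walkSign σ p *_)
               (trans (walkSign-◅◅ σ (e ◅ c) (f ◅ q))
                      (cong (_* walkSign σ (f ◅ q)) (bounded k (e ◅ c) c<k))))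
        (trans (sym (walkSign-◅◅ σ p (f ◅ q))) (bounded k (p ◅◅ f ◅ q) pq<k)))
    where
    total : walkLength (p ◅◅ (e ◅ c) ◅◅ (f ◅ q))
            ≡ walkLength p + (walkLength (e ◅ c) + walkLength (f ◅ q))
    total = trans (walkLength-◅◅ p _)
                  (cong (walkLength p +_) (walkLength-◅◅ (e ◅ c) (f ◅ q)))

    c<k : walkLength (e ◅ c) < k
    c<k = begin-strict
      walkLength (e ◅ c)                                        <⟨ ℕ.m<m+n _ (s≤s z≤n) ⟩
      walkLength (e ◅ c) + walkLength (f ◅ q)                   ≤⟨ ℕ.m≤n+m _ (walkLength p) ⟩
      walkLength p + (walkLength (e ◅ c) + walkLength (f ◅ q))  ≡⟨ total ⟨
      walkLength (p ◅◅ (e ◅ c) ◅◅ (f ◅ q))                      ≤⟨ l≤k ⟩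
      k                                                         ∎

    pq<k : walkLength (p ◅◅ f ◅ q) < k
    pq<k = begin-strict
      walkLength (p ◅◅ f ◅ q)                                   ≡⟨ walkLength-◅◅ p (f ◅ q) ⟩
      walkLength p + walkLength (f ◅ q)
        <⟨ ℕ.+-monoʳ-< (walkLength p) (ℕ.m<n+m _ (s≤s z≤n)) ⟩
      walkLength p + (walkLength (e ◅ c) + walkLength (f ◅ q))  ≡⟨ total ⟨
      walkLength (p ◅◅ (e ◅ c) ◅◅ (f ◅ q))                      ≤⟨ l≤k ⟩
      k                                                         ∎

-- Keeps the sign of a walk as an index, so that trading an edge for a walk reduces to an equation
-- between signs.
Reaches : ∀ {m} {G : Graph m} → Signature G → Fin m → Fin m → Sign → Set
Reaches {G = G} σ u v s = Σ (Walk G u v) λ p → walkSign σ p ≡ s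

module _ {m} {G : Graph m} {σ : Signature G} where

  reaches-refl : ∀ {u} → Reaches σ u u Sign.+
  reaches-refl = ε , refl

  reaches-edge : ∀ {u v} (e : Adj G u v) → Reaches σ u v (sign σ u v e)
  reaches-edge e = e ◅ ε , Sign.*-identityʳ _

  reaches-trans : ∀ {u v w s t} → Reaches σ u v s → Reaches σ v w t → Reaches σ u w (s * t)
  reaches-trans (p , refl) (q , refl) = p ◅◅ q , walkSign-◅◅ σ p q

  reaches-sym : ∀ {u v s} → Reaches σ u v s → Reaches σ v u s
  reaches-sym (ε , refl) = reaches-refl
  reaches-sym {s = s} (_◅_ {u} {w} e p , refl) =
    subst (Reaches σ _ _)
      (trans (cong (walkSign σ p *_) (sym (sign-sym σ u w e e′)))
             (Sign.*-comm (walkSign σ p) (sign σ u w e)))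
      (reaches-trans (reaches-sym (p , refl)) (reaches-edge e′))
    where
    e′ : Adj G w u
    e′ = subst T (adj-sym G u w) e

s*t*s≡t : ∀ s t → s * t * s ≡ t
s*t*s≡t Sign.+ Sign.+ = refl
s*t*s≡t Sign.+ Sign.- = refl
s*t*s≡t Sign.- Sign.+ = refl
s*t*s≡t Sign.- Sign.- = refl

s*t*u≡u*t*s : ∀ s t u → s * t * u ≡ u * t * s
s*t*u≡u*t*s Sign.+ t Sign.+ = refl
s*t*u≡u*t*s Sign.+ Sign.+ Sign.- = refl
s*t*u≡u*t*s Sign.+ Sign.- Sign.- = refl
s*t*u≡u*t*s Sign.- Sign.+ Sign.+ = refl
s*t*u≡u*t*s Sign.- Sign.- Sign.+ = refl
s*t*u≡u*t*s Sign.- t Sign.- = refl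

-- When two switched walks are joined, the switching sign `u` at their common vertex occurs twice
-- and cancels.
telescope : ∀ s t u v w → (s * t * u) * (u * v * w) ≡ s * (t * v) * w
telescope s t u v w =
  trans (sym (Sign.*-assoc (s * t * u) (u * v) w))
    (cong (_* w) (trans (sym (Sign.*-assoc (s * t * u) u v))
      (trans (cong (_* v) (trans (Sign.*-assoc (s * t) u u)
               (trans (cong (s * t *_) (Sign.s*s≡+ u)) (Sign.*-identityʳ (s * t)))))
             (Sign.*-assoc s t v))))

-- Balance pulls back along a map of vertices that sends edges to walks and
-- respects signs up to the switching s.
balanced-pullback : ∀ {m} {H K : Graph m} {τ : Signature H} {κ : Signature K}
  (φ : Fin m → Fin m) (s : Fin m → Sign) →
  (∀ u v (e : Adj H u v) → Reaches κ (φ u) (φ v) (s u * sign τ u v e * s v)) →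
  Balanced κ → Balanced τ
balanced-pullback {H = H} {τ = τ} {κ} φ s edge↦ bal {u} p _ with walk↦ p
  where
  walk↦ : ∀ {u v} (p : Walk H u v) → Reaches κ (φ u) (φ v) (s u * walkSign τ p * s v)
  walk↦ {u} ε = ε , sym (s*t*s≡t (s u) Sign.+)
  walk↦ {u} {w} (_◅_ {v = v} e p) =
    subst (Reaches κ _ _) (telescope (s u) (sign τ u v e) (s v) (walkSign τ p) (s w))
      (reaches-trans (edge↦ u v e) (walk↦ p))
-- The image `q` of a cycle need not be a cycle, so positivity of all closed walks is needed. The
-- switching sign at the base vertex cancels against itself.
... | q , eq = trans (sym (s*t*s≡t (s u) (walkSign τ p)))
                     (trans (sym eq) (closedWalk-positive bal q))

-- Numbers of edges

-- Without repetitions in `xs`, mapping each position in `xs` to one in `ys` with the same entry is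
-- injective.
unique-⊆⇒length≤ : ∀ {A : Set} {xs ys : List A} → Unique xs →
                   (∀ {x} → x ∈ₗ xs → x ∈ₗ ys) → length xs ≤ length ys
unique-⊆⇒length≤ {xs = xs} {ys} uniq xs⊆ys = Fin.injective⇒≤ position-injective
  where
  position : Fin (length xs) → Fin (length ys)
  position i = index (xs⊆ys (∈-lookup i))

  position-injective : ∀ {i j} → position i ≡ position j → i ≡ j
  position-injective {i} {j} eq with
    trans (lookup-index (xs⊆ys (∈-lookup i)))
      (trans (cong (List.lookup ys) eq) (sym (lookup-index (xs⊆ys (∈-lookup j)))))
  ... | same with Fin.<-cmp i j
  ...   | tri< i<j _ _ = contradiction same (lookup-≢ uniq i j i<j)
  ...   | tri≈ _ i≡j _ = i≡j
  ...   | tri> _ _ j<i = contradiction (sym same) (lookup-≢ uniq j i j<i)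

edges-unique : ∀ {m} (G : Graph m) → Unique (edges G)
edges-unique {m} G =
  Unique.filter⁺ _ (Unique.cartesianProduct⁺ (Unique.allFin⁺ m) (Unique.allFin⁺ m))

∈-edges⁺ : ∀ {m} (G : Graph m) {u v} → u Fin.< v → Adj G u v → (u , v) ∈ₗ edges G
∈-edges⁺ G {u} {v} u<v e =
  ∈-filter⁺ _ (∈-cartesianProduct⁺ (∈-allFin u) (∈-allFin v)) (u<v , e)

∈-edges⁻ : ∀ {m} (G : Graph m) {u v} → (u , v) ∈ₗ edges G → u Fin.< v × Adj G u v
∈-edges⁻ {m} G e∈ =
  proj₂ (∈-filter⁻ (λ (u , v) → (u Fin.<? v) ×-dec T? (adj G u v))
                   {xs = List.cartesianProduct (List.allFin m) (List.allFin m)} e∈)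

adj-symmetric : ∀ {m} (G : Graph m) {u v} → Adj G u v → Adj G v u
adj-symmetric G {u} {v} = subst T (adj-sym G u v)

adj-≢ : ∀ {m} (G : Graph m) {u v} → Adj G u v → u ≢ v
adj-≢ G {u} e refl = subst T (adj-irrefl G u) e

∖⁺ : ∀ {m} (G F : Graph m) {u v} → Adj G u v → ¬ Adj F u v → Adj (G ∖ F) u v
∖⁺ G F {u} {v} e ¬f = Equivalence.from T-∧ (e , T-not (adj F u v) ¬f)
  where
  T-not : ∀ b → ¬ T b → T (not b)
  T-not false _  = _
  T-not true  ¬t = ¬t _

∖⁻ : ∀ {m} (G F : Graph m) {u v} → Adj (G ∖ F) u v → ¬ Adj F u v
∖⁻ G F {u} {v} e f = T-contradiction (adj F u v) f (proj₂ (Equivalence.to T-∧ e))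
  where
  T-contradiction : ∀ b → T b → ¬ T (not b)
  T-contradiction true _ ()

infixl 6 _⊔_

_⊔_ : ∀ {m} → Graph m → Graph m → Graph m
(F ⊔ H) .adj u v = adj F u v ∨ adj H u v
(F ⊔ H) .adj-sym u v = cong₂ _∨_ (adj-sym F u v) (adj-sym H u v)
(F ⊔ H) .adj-irrefl v = cong₂ _∨_ (adj-irrefl F v) (adj-irrefl H v)

⊔⁻ : ∀ {m} (F H : Graph m) {u v} → Adj (F ⊔ H) u v → Adj F u v ⊎ Adj H u v
⊔⁻ F H = Equivalence.to T-∨

⊔⁺ˡ : ∀ {m} (F H : Graph m) {u v} → Adj F u v → Adj (F ⊔ H) u v
⊔⁺ˡ F H e = Equivalence.from T-∨ (inj₁ e)

⊔⁺ʳ : ∀ {m} (F H : Graph m) {u v} → Adj H u v → Adj (F ⊔ H) u v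
⊔⁺ʳ F H e = Equivalence.from (T-∨ {adj F _ _}) (inj₂ e)

edge : ∀ {m} (p q : Fin m) → p ≢ q → Graph m
edge p q p≢q .adj u v = (⌊ u Fin.≟ p ⌋ ∧ ⌊ v Fin.≟ q ⌋) ∨ (⌊ u Fin.≟ q ⌋ ∧ ⌊ v Fin.≟ p ⌋)
edge p q p≢q .adj-sym u v =
  trans (∨-comm (⌊ u Fin.≟ p ⌋ ∧ ⌊ v Fin.≟ q ⌋) _)
        (cong₂ _∨_ (∧-comm ⌊ u Fin.≟ q ⌋ _) (∧-comm ⌊ u Fin.≟ p ⌋ _))
edge p q p≢q .adj-irrefl v with v Fin.≟ p | v Fin.≟ q
... | yes refl | yes refl = contradiction refl p≢q
... | yes _    | no _     = refl
... | no _     | yes _    = refl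
... | no _     | no _     = refl

module _ {m} {p q : Fin m} (p≢q : p ≢ q) where

  edge⁻ : ∀ {u v} → Adj (edge p q p≢q) u v → (u ≡ p × v ≡ q) ⊎ (u ≡ q × v ≡ p)
  edge⁻ {u} {v} e with u Fin.≟ p | v Fin.≟ q | u Fin.≟ q | v Fin.≟ p
  ... | yes u≡p | yes v≡q | _       | _       = inj₁ (u≡p , v≡q)
  ... | yes _   | no _    | yes u≡q | yes v≡p = inj₂ (u≡q , v≡p)
  ... | no _    | _       | yes u≡q | yes v≡p = inj₂ (u≡q , v≡p)

  edge⁺ : Adj (edge p q p≢q) p q
  edge⁺ = Equivalence.from T-∨
    (inj₁ (Equivalence.from T-∧ (fromWitness {a? = p Fin.≟ p} refl ,
                                 fromWitness {a? = q Fin.≟ q} refl)))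

  edge-⊑ : ∀ (G : Graph m) → Adj G p q → edge p q p≢q ⊑ G
  edge-⊑ G e u v f with edge⁻ {u} {v} f
  ... | inj₁ (refl , refl) = e
  ... | inj₂ (refl , refl) = adj-symmetric G e

  -- Since `edges` lists only increasing pairs, a one-edge graph can add only this single pair to
  -- it.
  sortedEdge : Σ (Fin m × Fin m) λ pq →
               ∀ {u v} → u Fin.< v → Adj (edge p q p≢q) u v → (u , v) ≡ pq
  sortedEdge with Fin.<-cmp p q
  ... | tri≈ _ p≡q _ = contradiction p≡q p≢q
  ... | tri< p<q _ _ = (p , q) , λ {u} {v} u<v e → case u<v (edge⁻ {u} {v} e)
    where
    case : ∀ {u v} → u Fin.< v → (u ≡ p × v ≡ q) ⊎ (u ≡ q × v ≡ p) → (u , v) ≡ (p , q)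
    case _   (inj₁ (refl , refl)) = refl
    case u<v (inj₂ (refl , refl)) = contradiction u<v (ℕ.<-asym p<q)
  ... | tri> _ _ q<p = (q , p) , λ {u} {v} u<v e → case u<v (edge⁻ {u} {v} e)
    where
    case : ∀ {u v} → u Fin.< v → (u ≡ p × v ≡ q) ⊎ (u ≡ q × v ≡ p) → (u , v) ≡ (q , p)
    case u<v (inj₁ (refl , refl)) = contradiction u<v (ℕ.<-asym q<p)
    case _   (inj₂ (refl , refl)) = refl

-- Some edge of `F` lies in `R`, and its removal makes room for the new edge: both sizes are
-- compared with one more than the size of `F` without `R`. The inequality may be strict, as `R` may
-- meet `F` in several edges and the new edge may be present already.
size-exchange : ∀ {m} (F R : Graph m) {u v p q : Fin m} (p≢q : p ≢ q) →
                Adj F u v → Adj R u v → size ((F ∖ R) ⊔ edge p q p≢q) ≤ size F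
size-exchange {m} F R {p = p} {q} p≢q f r with sortedRemoved f r
  where
  sortedRemoved : ∀ {u v} → Adj F u v → Adj R u v →
                  ∃₂ λ u v → u Fin.< v × Adj F u v × Adj R u v
  sortedRemoved {u} {v} f r with Fin.<-cmp u v
  ... | tri< u<v _ _ = u , v , u<v , f , r
  ... | tri≈ _ u≡v _ = contradiction u≡v (adj-≢ F f)
  ... | tri> _ _ v<u = v , u , v<u , adj-symmetric F f , adj-symmetric R r
... | u , v , u<v , f′ , r′ = ℕ.≤-trans
  (unique-⊆⇒length≤ {ys = pq ∷ edges (F ∖ R)} (edges-unique F′) exchanged)
  (unique-⊆⇒length≤ {xs = (u , v) ∷ edges (F ∖ R)}
    (All.¬Any⇒All¬ _ (λ uv∈ → ∖⁻ F R {u} {v} (proj₂ (∈-edges⁻ (F ∖ R) uv∈)) r′)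
      ∷ edges-unique (F ∖ R))
    λ where
      (here refl) → ∈-edges⁺ F u<v f′
      (there xy∈) → let x<y , e = ∈-edges⁻ (F ∖ R) xy∈ in ∈-edges⁺ F x<y (∖-⊑ F R _ _ e))
  where
  F′ : Graph m
  F′ = (F ∖ R) ⊔ edge p q p≢q

  pq : Fin m × Fin m
  pq = proj₁ (sortedEdge p≢q)

  exchanged : ∀ {xy} → xy ∈ₗ edges F′ → xy ∈ₗ (pq ∷ edges (F ∖ R))
  exchanged {x , y} xy∈ with ∈-edges⁻ F′ xy∈
  ... | x<y , e with ⊔⁻ (F ∖ R) (edge p q p≢q) {x} {y} e
  ...   | inj₁ e′ = there (∈-edges⁺ (F ∖ R) x<y e′)
  ...   | inj₂ e′ = here (proj₂ (sortedEdge p≢q) x<y e′)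

-- Cardinalities and degrees

∣p∪q∣≤∣p∣+∣q∣ : ∀ {n} (p q : Subset n) → ∣ p ∪ q ∣ ≤ ∣ p ∣ + ∣ q ∣
∣p∪q∣≤∣p∣+∣q∣ [] [] = z≤n
∣p∪q∣≤∣p∣+∣q∣ (inside  ∷ p) (inside  ∷ q) =
  s≤s (ℕ.≤-trans (∣p∪q∣≤∣p∣+∣q∣ p q) (ℕ.+-monoʳ-≤ ∣ p ∣ (ℕ.n≤1+n ∣ q ∣)))
∣p∪q∣≤∣p∣+∣q∣ (inside  ∷ p) (outside ∷ q) = s≤s (∣p∪q∣≤∣p∣+∣q∣ p q)
∣p∪q∣≤∣p∣+∣q∣ (outside ∷ p) (inside  ∷ q) =
  subst (suc ∣ p ∪ q ∣ ≤_) (sym (ℕ.+-suc ∣ p ∣ ∣ q ∣)) (s≤s (∣p∪q∣≤∣p∣+∣q∣ p q))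
∣p∪q∣≤∣p∣+∣q∣ (outside ∷ p) (outside ∷ q) = ∣p∪q∣≤∣p∣+∣q∣ p q

∈-neighbours⁺ : ∀ {m} (G : Graph m) {u v} → Adj G u v → v ∈ neighbours G u
∈-neighbours⁺ G {u} {v} e = lookup⇒[]= v _ (trans (lookup∘tabulate _ v) (Equivalence.to T-≡ e))

∈-neighbours⁻ : ∀ {m} (G : Graph m) {u v} → v ∈ neighbours G u → Adj G u v
∈-neighbours⁻ G {u} {v} v∈ =
  Equivalence.from T-≡ (trans (sym (lookup∘tabulate _ v)) ([]=⇒lookup v∈))

∈-distinct₃⇒3≤∣p∣ : ∀ {n} {p : Subset n} {x y z} → x ∈ p → y ∈ p → z ∈ p →
                    y ≢ x → z ≢ x → z ≢ y → 3 ≤ ∣ p ∣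
∈-distinct₃⇒3≤∣p∣ x∈ y∈ z∈ y≢x z≢x z≢y =
  ℕ.≤-trans (s≤s (ℕ.≤-trans (s≤s (ℕ.≤-trans (s≤s z≤n) (x∈p⇒∣p-x∣<∣p∣ z∈′))) (x∈p⇒∣p-x∣<∣p∣ y∈′)))
            (x∈p⇒∣p-x∣<∣p∣ x∈)
  where
  y∈′ = x∈p∧x≢y⇒x∈p-y y∈ y≢x
  z∈′ = x∈p∧x≢y⇒x∈p-y (x∈p∧x≢y⇒x∈p-y z∈ z≢x) z≢y

twoNeighbours : ∀ {m} (G : Graph m) {u x y} → degree G u ≡ 2 → Adj G u x → Adj G u y →
                x ≢ y → ∀ z → Adj G u z → z ≡ x ⊎ z ≡ y
twoNeighbours G {x = x} {y} d≡2 ux uy x≢y z uz with z Fin.≟ x | z Fin.≟ y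
... | yes z≡x | _       = inj₁ z≡x
... | no _    | yes z≡y = inj₂ z≡y
... | no z≢x  | no z≢y  = contradiction
  (∈-distinct₃⇒3≤∣p∣ (∈-neighbours⁺ G ux) (∈-neighbours⁺ G uy) (∈-neighbours⁺ G uz)
    (≢-sym x≢y) z≢x z≢y)
  (ℕ.<⇒≱ (s≤s (ℕ.≤-reflexive d≡2)))

anotherNeighbour : ∀ {m} (G : Graph m) {u v} → Adj G u v → degree G u ≢ 1 →
                   ∃ λ x → Adj G u x × x ≢ v
anotherNeighbour G {u} {v} e d≢1 with
  Fin.any? (λ x → T? (adj G u x) ×-dec ¬? (x Fin.≟ v))
... | yes found = found
... | no none = contradiction
  (ℕ.≤-antisym
    (subst (degree G u ≤_) (∣⁅x⁆∣≡1 v) (p⊆q⇒∣p∣≤∣q∣ ⊆⁅v⁆))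
    (ℕ.≤-trans (s≤s z≤n) (x∈p⇒∣p-x∣<∣p∣ (∈-neighbours⁺ G e))))
  d≢1
  where
  ⊆⁅v⁆ : neighbours G u ⊆ ⁅ v ⁆
  ⊆⁅v⁆ {x} x∈ with x Fin.≟ v
  ... | yes refl = x∈⁅x⁆ v
  ... | no x≢v   = contradiction (x , ∈-neighbours⁻ G x∈ , x≢v) none

thirdNeighbour : ∀ {m} (G : Graph m) u v w → 3 ≤ degree G u →
                 ∃ λ x → Adj G u x × x ≢ v × x ≢ w
thirdNeighbour G u v w 3≤d with
  Fin.any? (λ x → T? (adj G u x) ×-dec ¬? (x Fin.≟ v) ×-dec ¬? (x Fin.≟ w))
... | yes found = found
... | no none = contradiction
  (ℕ.≤-trans (p⊆q⇒∣p∣≤∣q∣ ⊆⁅v⁆∪⁅w⁆)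
    (ℕ.≤-trans (∣p∪q∣≤∣p∣+∣q∣ ⁅ v ⁆ ⁅ w ⁆)
      (ℕ.≤-reflexive (cong₂ _+_ (∣⁅x⁆∣≡1 v) (∣⁅x⁆∣≡1 w)))))
  (ℕ.<⇒≱ 3≤d)
  where
  ⊆⁅v⁆∪⁅w⁆ : neighbours G u ⊆ (⁅ v ⁆ ∪ ⁅ w ⁆)
  ⊆⁅v⁆∪⁅w⁆ {x} x∈ with x Fin.≟ v | x Fin.≟ w
  ... | yes refl | _        = p⊆p∪q ⁅ w ⁆ (x∈⁅x⁆ v)
  ... | no _     | yes refl = q⊆p∪q ⁅ v ⁆ ⁅ w ⁆ (x∈⁅x⁆ w)
  ... | no x≢v   | no x≢w   = contradiction (x , ∈-neighbours⁻ G x∈ , x≢v , x≢w) none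

∣tabulate∣-punchIn : ∀ {n} (f : Fin (suc n) → Bool) h → f h ≡ true →
                     ∣ tabulate f ∣ ≡ suc ∣ tabulate (f ∘ punchIn h) ∣
∣tabulate∣-punchIn f zero eq rewrite eq = refl
∣tabulate∣-punchIn {suc n} f (suc h) eq with f zero
... | true  = cong suc (∣tabulate∣-punchIn (f ∘ suc) h eq)
... | false = ∣tabulate∣-punchIn (f ∘ suc) h eq

-- The apex itself is the one extra neighbour.
degree-punchIn : ∀ {m} (G : Graph (suc m)) h v → Adj G h (punchIn h v) →
                 degree G (punchIn h v) ≡ suc (degree (G - h) v)
degree-punchIn G h v e =
  ∣tabulate∣-punchIn (adj G (punchIn h v)) h (Equivalence.to T-≡ (adj-symmetric G e))

-- Leaves

-- Without leaves, a path could be prolonged forever.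
leaf-exists : ∀ {m} {G : Graph m} → IsTree G → 2 ≤ m → ∃ λ v → degree G v ≡ 1
leaf-exists {suc zero} _ (s≤s ())
leaf-exists {suc (suc m)} {G} isTree _ with Fin.any? (λ v → degree G v ℕ.≟ 1)
... | yes found = found
... | no none with Connected.walk (IsTree.connected isTree) zero (suc zero)
...   | e₀ ◅ _ = contradiction
  -- The walk `p` has at least as many distinct sources as `G` has vertices, and `u` is one more.
  (let _ , _ , _ , e , p , uniq , long = path (suc (suc m)) in
   ℕ.≤-trans (s≤s long) (unique⇒length≤ uniq))
  ℕ.1+n≰n
  where
  -- The path grows at its front. Its first edge `e` is kept apart so that the next vertex can be a
  -- neighbour of `u` other than `v`; the far end `w` is exempt from distinctness.
  Path : ℕ → Set
  Path k = ∃₂ λ u v → Σ (Fin _) λ w → Σ (Adj G u v) λ e → Σ (Walk G v w) λ p →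
           Unique (u ∷ sources p) × k ≤ walkLength p

  prolong : ∀ {k} → Path k → Path (suc k)
  prolong (u , v , w , e , p , uniq@(u∉p ∷ uniq-p) , k≤) with anotherNeighbour G e (λ d → none (u , d))
  ... | x , ux , x≢v with any? (x Fin.≟_) (sources p)
  ...   | no x∉p = x , u , w , adj-symmetric G ux , e ◅ p ,
                   (≢-sym (adj-≢ G ux) ∷ All.¬Any⇒All¬ _ x∉p) ∷ uniq , s≤s k≤
  ...   | yes x∈p with splitAt p x∈p
  ...     | ε , _ , _ , _ , _ = contradiction refl x≢v
  -- The cycle goes from `x` to `u` to `v` and along `q` back to `x`. It has at least three vertices
  -- because `q` is non-empty.
  ...     | q@(_ ◅ _) , _ , f , r , refl = ⊥-elim
    (IsTree.acyclic isTree (adj-symmetric G ux ◅ e ◅ q)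
      (s≤s (s≤s (s≤s z≤n)) , cycle (sources-◅◅ q (f ◅ r))))
    where
    cycle : sources p ≡ sources q ++ x ∷ sources r → Unique (x ∷ u ∷ sources q)
    cycle eq with unique-rotate (sources q) (subst Unique eq uniq-p)
                | All.++⁻ˡ (sources q) (subst (All (u ≢_)) eq u∉p)
    ... | x∉q ∷ uniq-q | u∉q = (≢-sym (adj-≢ G ux) ∷ x∉q) ∷ u∉q ∷ uniq-q

  path : ∀ k → Path k
  path zero = zero , _ , _ , e₀ , ε , [] ∷ [] , z≤n
  path (suc k) = prolong (path k)

-- Negative triangles at a vertex of degree two

-- In the application `a` is the apex, `b` a leaf of the tree and `c` the tree neighbour of `b`.
module NegativeTriangle {m} {G : Graph m} {a b c : Fin m}
  (ba : Adj G b a) (bc : Adj G b c) (ac : Adj G a c)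
  (b-neighbours : ∀ x → Adj G b x → x ≡ a ⊎ x ≡ c) where

  a≢b : a ≢ b
  a≢b = ≢-sym (adj-≢ G ba)

  c≢b : c ≢ b
  c≢b = ≢-sym (adj-≢ G bc)

  a≢c : a ≢ c
  a≢c = adj-≢ G ac

  Edge-ab Edge-bc Edge-ac : Graph m
  Edge-ab = edge a b a≢b
  Edge-bc = edge c b c≢b
  Edge-ac = edge a c a≢c

  -- As σ and τ differ on ac, the path equations say that the triangle abc is
  -- negative in both.
  record Twisted (σ τ : Signature G) : Set where
    field
      σ-path  : sign σ b a ba * sign σ b c bc ≡ sign τ a c ac
      τ-path  : sign τ b a ba * sign τ b c bc ≡ sign σ a c ac
      differ  : sign σ a c ac ≢ sign τ a c ac
      agree   : ∀ u v (e : Adj G u v) → u ≢ b → v ≢ b → ¬ Adj Edge-ac u v →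
                sign σ u v e ≡ sign τ u v e

  open Twisted

  twisted-sym : ∀ {σ τ} → Twisted σ τ → Twisted τ σ
  twisted-sym t .σ-path = τ-path t
  twisted-sym t .τ-path = σ-path t
  twisted-sym t .differ = ≢-sym (differ t)
  twisted-sym t .agree u v e u≢b v≢b ¬ac = sym (agree t u v e u≢b v≢b ¬ac)

  module _ {σ τ : Signature G} (twisted : Twisted σ τ) (F : Graph m) where

    private
      κ : Signature (G ∖ F)
      κ = restrict (∖-⊑ G F) σ

    reaches-κ : ∀ {u v} (e : Adj G u v) → ¬ Adj F u v → Reaches κ u v (sign σ u v e)
    reaches-κ {u} {v} e ¬f =
      subst (Reaches κ u v) (cong (sign σ u v) (T-irrelevant _ _))
            (reaches-edge (∖⁺ G F e ¬f))

    -- Pullback along the map that sends `b` to `d` and fixes every other vertex, with switching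
    -- sign `s₀` at `b`. Each edge of the triangle that `F′` spares must be matched by a walk
    -- avoiding `F`; the condition is vacuous for an edge in `F′`. The remaining edges stand for
    -- themselves.
    collapse : (F′ : Graph m) (d : Fin m) (s₀ : Sign) →
               (¬ Adj F′ b a → Reaches κ d a (s₀ * sign τ b a ba)) →
               (¬ Adj F′ b c → Reaches κ d c (s₀ * sign τ b c bc)) →
               (¬ Adj F′ a c → Reaches κ a c (sign τ a c ac)) →
               (∀ u v → u ≢ b → v ≢ b → ¬ Adj Edge-ac u v → Adj F u v → Adj F′ u v) →
               BalancedAfterDeleting σ F → BalancedAfterDeleting τ F′
    collapse F′ d s₀ d⇝a d⇝c a⇝c rest =
      balanced-pullback {τ = restrict (∖-⊑ G F′) τ} φ s link
      where
      φ : Fin m → Fin m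
      φ = updateAt id b (const d)

      s : Fin m → Sign
      s = updateAt (const Sign.+) b (const s₀)

      Link : Fin m → Fin m → Set
      Link u v = (e : Adj (G ∖ F′) u v) →
                 Reaches κ (φ u) (φ v) (s u * sign τ u v (∖-⊑ G F′ u v e) * s v)

      link-sym : ∀ {u v} → Link u v → Link v u
      link-sym {u} {v} l e =
        subst (Reaches κ _ _)
          (trans (s*t*u≡u*t*s (s u) _ (s v))
                 (cong (λ t → s v * t * s u) (sign-sym τ u v _ _)))
          (reaches-sym (l (adj-symmetric (G ∖ F′) e)))

      link-from-b : ∀ {x} (bx : Adj G b x) → (¬ Adj F′ b x → Reaches κ d x (s₀ * sign τ b x bx)) →
                    x ≢ b → Link b x
      link-from-b {x} bx d⇝x x≢b e
        rewrite updateAt-updates b {const d} id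
              | updateAt-updates b {const s₀} (const Sign.+)
              | updateAt-minimal x b {const d} id x≢b
              | updateAt-minimal x b {const s₀} (const Sign.+) x≢b =
        subst (Reaches κ d x)
          (trans (cong (λ f → s₀ * sign τ b x f) (T-irrelevant _ _)) (sym (Sign.*-identityʳ _)))
          (d⇝x (∖⁻ G F′ {b} {x} e))

      link-off-b : ∀ {u v} (uv : Adj G u v) → (¬ Adj F′ u v → Reaches κ u v (sign τ u v uv)) →
                   u ≢ b → v ≢ b → Link u v
      link-off-b {u} {v} uv u⇝v u≢b v≢b e
        rewrite updateAt-minimal u b {const d} id u≢b
              | updateAt-minimal u b {const s₀} (const Sign.+) u≢b
              | updateAt-minimal v b {const d} id v≢b
              | updateAt-minimal v b {const s₀} (const Sign.+) v≢b =
        subst (Reaches κ u v)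
          (trans (cong (sign τ u v) (T-irrelevant _ _)) (sym (Sign.*-identityʳ _)))
          (u⇝v (∖⁻ G F′ {u} {v} e))

      link-b : ∀ x → Link b x
      link-b x e with b-neighbours x (∖-⊑ G F′ b x e)
      ... | inj₁ refl = link-from-b ba d⇝a a≢b e
      ... | inj₂ refl = link-from-b bc d⇝c c≢b e

      link : ∀ u v → Link u v
      link u v e with u Fin.≟ b | v Fin.≟ b
      ... | yes refl | _        = link-b v e
      ... | no _     | yes refl = link-sym (link-b u) e
      ... | no u≢b   | no v≢b with T? (adj Edge-ac u v)
      ...   | no ¬ac = link-off-b uv
                -- By `rest` an edge spared by `F′` is spared by `F` here, and `σ` and `τ` give it
                -- the same sign.
                (λ ¬f′ → subst (Reaches κ u v) (agree twisted u v uv u≢b v≢b ¬ac)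
                           (reaches-κ uv (¬f′ ∘ rest u v u≢b v≢b ¬ac)))
                u≢b v≢b e
        where
        uv : Adj G u v
        uv = ∖-⊑ G F′ u v e
      ...   | yes is-ac with edge⁻ a≢c {u} {v} is-ac
      ...     | inj₁ (refl , refl) = link-off-b ac a⇝c u≢b v≢b e
      ...     | inj₂ (refl , refl) = link-sym (link-off-b ac a⇝c v≢b u≢b) e

    Exchange : Set
    Exchange = ∃ λ F′ → F′ ⊑ G × size F′ ≤ size F × BalancedAfterDeleting τ F′

    module _ (F⊑G : F ⊑ G) (bal : BalancedAfterDeleting σ F) where

      replace-⊑ : (R : Graph m) {p q : Fin m} (p≢q : p ≢ q) → Adj G p q →
                  ((F ∖ R) ⊔ edge p q p≢q) ⊑ G
      replace-⊑ R p≢q pq u v e with ⊔⁻ (F ∖ R) (edge _ _ p≢q) {u} {v} e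
      ... | inj₁ f = F⊑G u v (∖-⊑ F R u v f)
      ... | inj₂ f = edge-⊑ p≢q G pq u v f

      replaced : (R : Graph m) {p q : Fin m} (p≢q : p ≢ q) →
                 Adj ((F ∖ R) ⊔ edge p q p≢q) p q
      replaced R p≢q = ⊔⁺ʳ (F ∖ R) (edge _ _ p≢q) (edge⁺ p≢q)

      kept : (R : Graph m) {p q : Fin m} (p≢q : p ≢ q) → ∀ {u v} →
             Adj F u v → ¬ Adj R u v → Adj ((F ∖ R) ⊔ edge p q p≢q) u v
      kept R p≢q f ¬r = ⊔⁺ˡ (F ∖ R) (edge _ _ p≢q) (∖⁺ F R f ¬r)

      Star-b : Graph m
      Star-b = Edge-ab ⊔ Edge-bc

      star-b : ∀ {u v} → Adj Star-b u v → u ≡ b ⊎ v ≡ b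
      star-b {u} {v} e with ⊔⁻ Edge-ab Edge-bc {u} {v} e
      ... | inj₁ f with edge⁻ a≢b {u} {v} f
      ...   | inj₁ (_ , v≡b) = inj₂ v≡b
      ...   | inj₂ (u≡b , _) = inj₁ u≡b
      star-b {u} {v} e | inj₂ f with edge⁻ c≢b {u} {v} f
      ...   | inj₁ (_ , v≡b) = inj₂ v≡b
      ...   | inj₂ (u≡b , _) = inj₁ u≡b

      ∉-star-b : ∀ {u v} → u ≢ b → v ≢ b → ¬ Adj Star-b u v
      ∉-star-b u≢b v≢b e with star-b e
      ... | inj₁ u≡b = u≢b u≡b
      ... | inj₂ v≡b = v≢b v≡b

      -- When `b` is contracted onto `c`, the edge `bc` becomes the empty walk; taking its own sign
      -- as `s₀` makes its switched sign positive.
      bc-contracted : Reaches κ c c (sign τ b c bc * sign τ b c bc)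
      bc-contracted = subst (Reaches κ c c) (sym (Sign.s*s≡+ (sign τ b c bc))) reaches-refl

      -- `F` has an edge at `b`, so giving up all edges at `b` pays for one new edge. If `ac` is not
      -- in `F`, it is the new edge, and its former copy carries the image of `ba` with the sign
      -- required by `τ-path`. If `ac` is in `F`, it stays deleted and `ab` is added, so that `b`
      -- can hang only on `c`.
      exchange-star : ∀ {x} → Adj F x b → Adj Star-b x b → Exchange
      exchange-star xb∈F xb∈Star with T? (adj F a c)
      ... | no ac∉F =
        F′ , replace-⊑ Star-b a≢c ac , size-exchange F Star-b a≢c xb∈F xb∈Star ,
        collapse F′ c (sign τ b c bc)
          (λ _ → subst (Reaches κ c a)
                   (trans (sym (τ-path twisted)) (Sign.*-comm (sign τ b a ba) _))
                   (reaches-sym (reaches-κ ac ac∉F)))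
          (λ _ → bc-contracted)
          (λ ac∉F′ → contradiction (replaced Star-b a≢c) ac∉F′)
          (λ u v u≢b v≢b _ f → kept Star-b a≢c {u} {v} f (∉-star-b u≢b v≢b))
          bal
        where
        F′ : Graph m
        F′ = (F ∖ Star-b) ⊔ Edge-ac
      ... | yes ac∈F =
        F′ , replace-⊑ Star-b a≢b (adj-symmetric G ba) ,
        size-exchange F Star-b a≢b xb∈F xb∈Star ,
        collapse F′ c (sign τ b c bc)
          (λ ba∉F′ → contradiction (adj-symmetric F′ (replaced Star-b a≢b)) ba∉F′)
          (λ _ → bc-contracted)
          (λ ac∉F′ → contradiction (kept Star-b a≢b {a} {c} ac∈F (∉-star-b a≢b c≢b)) ac∉F′)
          (λ u v u≢b v≢b _ f → kept Star-b a≢b {u} {v} f (∉-star-b u≢b v≢b))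
          bal
        where
        F′ : Graph m
        F′ = (F ∖ Star-b) ⊔ Edge-ab

      -- A set sparing both edges at `b` must contain `ac`, or the negative triangle would survive.
      -- Then `ac` is traded for `bc` and `b` is contracted onto `a`; the surviving path from `a`
      -- through `b` to `c` stands in for `ac`, with the sign given by `σ-path`.
      exchange-ac : ¬ Adj F b a → ¬ Adj F b c → Exchange
      exchange-ac ba∉F bc∉F with T? (adj F a c)
      ... | no ac∉F = contradiction ac-sign (differ twisted)
        where
        cycle : Reaches κ a a (sign σ a c ac * sign σ b c bc * sign σ b a ba)
        cycle = reaches-trans
          (reaches-trans (reaches-κ ac ac∉F) (reaches-sym (reaches-κ bc bc∉F)))
          (reaches-κ ba ba∉F)

        cancel : ∀ r s t → r * s * t ≡ Sign.+ → r ≡ t * s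
        cancel Sign.+ Sign.+ Sign.+ _ = refl
        cancel Sign.+ Sign.- Sign.- _ = refl
        cancel Sign.- Sign.+ Sign.- _ = refl
        cancel Sign.- Sign.- Sign.+ _ = refl

        ac-sign : sign σ a c ac ≡ sign τ a c ac
        ac-sign = trans
          (cancel _ _ _ (trans (sym (proj₂ cycle)) (closedWalk-positive bal (proj₁ cycle))))
          (σ-path twisted)
      ... | yes ac∈F =
        F′ , replace-⊑ Edge-ac c≢b (adj-symmetric G bc) ,
        size-exchange F Edge-ac c≢b ac∈F (edge⁺ a≢c) ,
        collapse F′ a (sign τ b a ba)
          (λ _ → subst (Reaches κ a a) (sym (Sign.s*s≡+ (sign τ b a ba))) reaches-refl)
          (λ bc∉F′ → contradiction (adj-symmetric F′ (replaced Edge-ac c≢b)) bc∉F′)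
          (λ _ → subst (Reaches κ a c) (σ-path twisted)
                   (reaches-trans (reaches-sym (reaches-κ ba ba∉F)) (reaches-κ bc bc∉F)))
          (λ u v _ _ ¬ac f → kept Edge-ac c≢b {u} {v} f ¬ac)
          bal
        where
        F′ : Graph m
        F′ = (F ∖ Edge-ac) ⊔ Edge-bc

      exchange : Exchange
      exchange with T? (adj F b a) | T? (adj F b c)
      ... | yes ba∈F | _        =
        exchange-star (adj-symmetric F ba∈F) (⊔⁺ˡ Edge-ab Edge-bc {a} {b} (edge⁺ a≢b))
      ... | no _     | yes bc∈F =
        exchange-star (adj-symmetric F bc∈F) (⊔⁺ʳ Edge-ab Edge-bc {c} {b} (edge⁺ c≢b))
      ... | no ba∉F  | no bc∉F  = exchange-ac ba∉F bc∉F

  frustrationIndex-≤ : ∀ {σ τ} → Twisted σ τ → frustrationIndex τ ≤ frustrationIndex σ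
  frustrationIndex-≤ {σ} {τ} twisted with proj₁ (frustrationIndex-isMinimum σ)
  ... | F , F⊑G , size≡ , bal with exchange twisted F F⊑G bal
  ...   | F′ , F′⊑G , size≤ , bal′ =
    ℕ.≤-trans (proj₂ (frustrationIndex-isMinimum τ) (size F′) (F′ , F′⊑G , refl , bal′))
              (subst (size F′ ≤_) size≡ size≤)

  frustrationIndex-twisted : ∀ {σ τ} → Twisted σ τ → frustrationIndex σ ≡ frustrationIndex τ
  frustrationIndex-twisted twisted =
    ℕ.≤-antisym (frustrationIndex-≤ (twisted-sym twisted)) (frustrationIndex-≤ twisted)

  -- The all-negative signature with two triangle edges reversed

  Reversed : Graph m
  Reversed = Edge-ab ⊔ Edge-ac

  reversed : Signature G
  reversed .sign u v _ = toSign (not (adj Reversed u v))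
  reversed .sign-sym u v _ _ = cong (toSign ∘ not) (adj-sym Reversed u v)

  ab∈Reversed : Adj Reversed a b
  ab∈Reversed = ⊔⁺ˡ Edge-ab Edge-ac {a} {b} (edge⁺ a≢b)

  reversed⁺ : ∀ {u v} (e : Adj G u v) → Adj Reversed u v → sign reversed u v e ≡ Sign.+
  reversed⁺ e r = cong (toSign ∘ not) (Equivalence.to T-≡ r)

  reversed⁻ : ∀ {u v} (e : Adj G u v) → ¬ Adj Reversed u v → sign reversed u v e ≡ Sign.-
  reversed⁻ {u} {v} _ = negative-unless (adj Reversed u v)
    where
    negative-unless : ∀ b → ¬ T b → toSign (not b) ≡ Sign.-
    negative-unless false _  = refl
    negative-unless true  ¬t = contradiction _ ¬t

  ∉-Reversed : ∀ {u v} → ¬ Adj Edge-ab u v → ¬ Adj Edge-ac u v → ¬ Adj Reversed u v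
  ∉-Reversed {u} {v} ¬ab ¬ac r with ⊔⁻ Edge-ab Edge-ac {u} {v} r
  ... | inj₁ f = ¬ab f
  ... | inj₂ f = ¬ac f

  -- The path through `b` has two negative edges for the first signature, and one positive and one
  -- negative edge for `reversed`, where `ac` is positive.
  allNegative-twisted : Twisted (allNegative G) reversed
  allNegative-twisted .σ-path = sym (reversed⁺ ac (⊔⁺ʳ Edge-ab Edge-ac {a} {c} (edge⁺ a≢c)))
  allNegative-twisted .τ-path = cong₂ _*_
    (reversed⁺ ba (adj-symmetric Reversed {a} {b} ab∈Reversed))
    (reversed⁻ bc (∉-Reversed {b} {c} bc-∉ab bc-∉ac))
    where
    bc-∉ab : ¬ Adj Edge-ab b c
    bc-∉ab e with edge⁻ a≢b {b} {c} e
    ... | inj₁ (b≡a , _) = a≢b (sym b≡a)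
    ... | inj₂ (_ , c≡a) = a≢c (sym c≡a)

    bc-∉ac : ¬ Adj Edge-ac b c
    bc-∉ac e with edge⁻ a≢c {b} {c} e
    ... | inj₁ (b≡a , _) = a≢b (sym b≡a)
    ... | inj₂ (b≡c , _) = c≢b (sym b≡c)
  allNegative-twisted .differ -≡τ
    with trans -≡τ (reversed⁺ ac (⊔⁺ʳ Edge-ab Edge-ac {a} {c} (edge⁺ a≢c)))
  ... | ()
  allNegative-twisted .agree u v e u≢b v≢b ¬ac =
    sym (reversed⁻ e (∉-Reversed {u} {v} ¬ab ¬ac))
    where
    ¬ab : ¬ Adj Edge-ab u v
    ¬ab f with edge⁻ a≢b {u} {v} f
    ... | inj₁ (_ , v≡b) = v≢b v≡b
    ... | inj₂ (u≡b , _) = u≢b u≡b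

  -- Since switching must turn every edge negative, `X` separates the ends of exactly those edges of
  -- `G` that lie in `Reversed`.
  module Switched (X : Subset m) (eq : switch X reversed ≗ₛ allNegative G) where

    switch-reversed : ∀ {u v} → Adj G u v → Adj Reversed u v → lookup X u ≢ lookup X v
    -- If both ends were on the same side of `X`, the edge would keep its positive sign, contrary to
    -- `eq`.
    switch-reversed {u} {v} e r same with
      trans (cong₂ (λ b s → if b then Sign.opposite s else s)
                   (sym (trans (cong (lookup X u xor_) (sym same)) (xor-same (lookup X u))))
                   (sym (reversed⁺ e r)))
            (eq u v e)
    ... | ()

    switch-kept : ∀ {u v} → Adj G u v → ¬ Adj Reversed u v → lookup X u ≡ lookup X v
    switch-kept {u} {v} e ¬r = agree-if (lookup X u) (lookup X v)
      (trans (cong (λ s → if lookup X u xor lookup X v then Sign.opposite s else s)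
                   (sym (reversed⁻ e ¬r)))
             (eq u v e))
      where
      agree-if : ∀ x y → (if x xor y then Sign.+ else Sign.-) ≡ Sign.- → x ≡ y
      agree-if false false _ = refl
      agree-if true  true  _ = refl

    a-b-separated : lookup X a ≢ lookup X b
    a-b-separated = switch-reversed (adj-symmetric G ba) ab∈Reversed

    a-joined : ∀ {x} → Adj G a x → x ≢ b → x ≢ c → lookup X a ≡ lookup X x
    a-joined {x} e x≢b x≢c = switch-kept e (∉-Reversed {a} {x} ¬ab ¬ac)
      where
      ¬ab : ¬ Adj Edge-ab a x
      ¬ab f with edge⁻ a≢b {a} {x} f
      ... | inj₁ (_ , x≡b) = x≢b x≡b
      ... | inj₂ (a≡b , _) = a≢b a≡b

      ¬ac : ¬ Adj Edge-ac a x
      ¬ac f with edge⁻ a≢c {a} {x} f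
      ... | inj₁ (_ , x≡c) = x≢c x≡c
      ... | inj₂ (a≡c , _) = a≢c a≡c

    joined-off-a : ∀ {u v} → Adj G u v → u ≢ a → v ≢ a → lookup X u ≡ lookup X v
    joined-off-a {u} {v} e u≢a v≢a = switch-kept e (∉-Reversed {u} {v} ¬ab ¬ac)
      where
      ¬ab : ¬ Adj Edge-ab u v
      ¬ab f with edge⁻ a≢b {u} {v} f
      ... | inj₁ (u≡a , _) = u≢a u≡a
      ... | inj₂ (_ , v≡a) = v≢a v≡a

      ¬ac : ¬ Adj Edge-ac u v
      ¬ac f with edge⁻ a≢c {u} {v} f
      ... | inj₁ (u≡a , _) = u≢a u≡a
      ... | inj₂ (_ , v≡a) = v≢a v≡a

-- The triangle at a leaf of an apex tree

module _ {m n} {G : Graph (suc m)} {h : Fin (suc m)} (apex : IsApexTree n G h) where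

  open IsApexTree apex

  -- Bundles the arguments of `NegativeTriangle` with the apex as `a` and the leaf as `b`.
  LeafTriangle : Fin m → Set
  LeafTriangle v = ∃ λ c → Adj G (punchIn h v) h × Adj G (punchIn h v) c × Adj G h c ×
                   (∀ z → Adj G (punchIn h v) z → z ≡ h ⊎ z ≡ c)

  leafTriangle : ∃ LeafTriangle
  leafTriangle with leaf-exists tree (ℕ.≤-pred (TwoConnected.order twoConnected))
  ... | v , leaf = v , triangle (triangles (punchIn h v) degree≡2)
    where
    hv : Adj G h (punchIn h v)
    hv = leaves v leaf

    vh : Adj G (punchIn h v) h
    vh = adj-symmetric G hv

    degree≡2 : degree G (punchIn h v) ≡ 2
    degree≡2 = trans (degree-punchIn G h v hv) (cong suc leaf)

    complete : ∀ {c} → Adj G (punchIn h v) c → Adj G h c → LeafTriangle v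
    complete vc hc = _ , vh , vc , hc , twoNeighbours G degree≡2 vh vc (adj-≢ G hc)

    triangle : InTriangle G (punchIn h v) → LeafTriangle v
    -- The triangle already uses both neighbours of the leaf, so `h` is one of `x` and `y`, and the
    -- other one serves as `c`.
    triangle (x , y , vx , xy , yv) with
      twoNeighbours G degree≡2 vx (adj-symmetric G yv) (adj-≢ G xy) h vh
    ... | inj₁ refl = complete (adj-symmetric G yv) xy
    ... | inj₂ refl = complete vx (adj-symmetric G xy)

theorem17 : ∀ {m} (n : ℕ) (G : Graph (suc m)) (h : Fin (suc m)) →
    IsApexTree n G h → n ≥ 3 →
    ¬ (frustrationIndex (allNegative G) ≡ maxFrustrationIndex G ×
    (∀ (σ : Signature G) → frustrationIndex σ ≡ maxFrustrationIndex G →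
    SwitchingEquivalent σ (allNegative G)))
theorem17 n G h apex n≥3 (maximal , unique) with leafTriangle apex
... | v , c , bh , bc , hc , b-neighbours with
  -- `reversed` also attains the maximum, so the assumed uniqueness yields a switching set.
  unique reversed (trans (sym (frustrationIndex-twisted allNegative-twisted)) maximal)
  where open NegativeTriangle {G = G} bh bc hc b-neighbours
-- Degree at least three gives an edge `hx` that is not reversed, so `h` and `x` lie on the same
-- side of `X`.
... | X , eq with thirdNeighbour G h (punchIn h v) c (subst (3 ≤_) (sym (IsApexTree.apexDegree apex)) n≥3)
... | x , hx , x≢b , x≢c = a-b-separated (trans (a-joined hx x≢b x≢c) x~b)
  where
  open NegativeTriangle {G = G} bh bc hc b-neighbours
  open Switched X eq

  -- Both reversed edges contain `h`, so no edge of the tree crosses `X`; a walk in the tree from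
  -- `x` to the leaf then puts the leaf on the side of `h`.
  constant : ∀ {u w} → Walk (G - h) u w → lookup X (punchIn h u) ≡ lookup X (punchIn h w)
  constant ε = refl
  constant (e ◅ p) = trans (joined-off-a e (Fin.punchInᵢ≢i h _) (Fin.punchInᵢ≢i h _)) (constant p)

  h≢x : h ≢ x
  h≢x = adj-≢ G hx

  x~b : lookup X x ≡ lookup X (punchIn h v)
  x~b = subst (λ y → lookup X y ≡ lookup X (punchIn h v)) (Fin.punchIn-punchOut h≢x)
    (constant (Connected.walk (IsTree.connected (IsApexTree.tree apex)) (punchOut h≢x) v))
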